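{- For every integer $L\geq 3$, the power series \[ H_{L,2}(q):=q^3+\delta_{L,4}\,q^9+\frac{q^2(1-q^{L+1})}{(q^2;q)_{L+1}}-\left(\frac{1}{(q^3;q)_L}-1\right) \] has all coefficients non-negative, where $\delta_{L,4}$ is the Kronecker delta.
   Context: $(a;q)_n=\prod_{i=0}^{n-1}(1-aq^i)$; expressions are expanded as formal power series in $q$. -}

module Defs where

open import Data.Nat using (ℕ; zero; suc; _+_; _≟_)
open import Data.Nat.Divisibility using (_∣?_)
open import Data.Integer using (ℤ; 0ℤ; 1ℤ) renaming (_+_ to _+ℤ_; _*_ to _*ℤ_; _-_ to _-ℤ_)
open import Data.List using (List; []; _∷_; foldr; map; upTo)
open import Relation.Nullary using (yes; no)

Series : Set
Series = ℕ → ℤ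

δ : ℕ → ℕ → ℤ
δ m n with m ≟ n
... | yes _ = 1ℤ
... | no _  = 0ℤ

q^ : ℕ → Series
q^ k n = δ n k

one : Series
one = q^ 0

_⊕_ : Series → Series → Series
(f ⊕ g) n = f n +ℤ g n

_⊖_ : Series → Series → Series
(f ⊖ g) n = f n -ℤ g n

_·_ : ℤ → Series → Series
(c · f) n = c *ℤ f n

sumℤ : List ℤ → ℤ
sumℤ = foldr _+ℤ_ 0ℤ

_⊛_ : Series → Series → Series
(f ⊛ g) n = sumℤ (map (λ i → f i *ℤ g (n Data.Nat.∸ i)) (upTo (suc n)))

infixl 7 _⊛_ _·_
infixl 6 _⊕_ _⊖_

-- 1/(1 - q^(suc k)) = Σ_j q^(j·(suc k)) as a formal power series
geom : ℕ → Series
geom k n with suc k ∣? n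
... | yes _ = 1ℤ
... | no _  = 0ℤ

-- 1/(q^(suc a);q)_n = ∏_{i=0}^{n-1} 1/(1 - q^(suc a + i))
invPochSuc : ℕ → ℕ → Series
invPochSuc a zero    = one
invPochSuc a (suc n) = invPochSuc a n ⊛ geom (a + n)

invPoch : (a : ℕ) → .{{_ : Data.Nat.NonZero a}} → ℕ → Series
invPoch (suc a) n = invPochSuc a n

H : ℕ → Series
H L = q^ 3 ⊕ δ L 4 · q^ 9
      ⊕ q^ 2 ⊛ (one ⊖ q^ (L + 1)) ⊛ invPoch 2 (L + 1)
      ⊖ (invPoch 3 L ⊖ one)

{-# OPTIONS --safe #-}

{-
Write M = n + 1 for the largest part and U n = 1/((1-q²)⋯(1-q^M)).  With n = L + 1,
H L = 1 + q³ + δ q⁹ + F, where F = (2q² - 1 - q^(M+1)) U.  Increasing M by one gives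
  F(M) = F(M-1) + q^(M+1) E(M),           E = (2q - 1 - q^(M-1)) U,
  E(M) = E(M-1) + q^(M-2) (G(M) + q³ (1 - q^(M-3)) U(M)),
  G(M) = G(M-1) + q^M G(M),               G = (1 - q)(1 - q²) U,
and (1 - q^(M-3)) U is non-negative because it only omits the part M - 3.  Each of G, E, F has
finitely many negative coefficients, all of small index, but the recurrences move them to
indices near M, where they must be absorbed.  The lower bounds that survive the step are
  G ≥ 1 - q + q³ + q^(M+2) + q^(M+3)                  (M ≥ 7),
  E ≥ -1 + 2q - q² + q³ + q^M + q^(M+1)               (M ≥ 8),
  F ≥ -1 - q³ + 2q^(M+2) + q^(M+4)                    (M ≥ 8).
What remains are finitely many rational functions f = p/D with D = (1-q²)⋯(1-q^M).  Such an f is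
non-negative if its first t coefficients are and (1 - q^a)(f - those t terms) is; iterating
this lowers the order of the poles until only a polynomial is left.
-}
module Submission where

open import Defs
open import Data.Nat using (ℕ; zero; suc; _+_; _∸_; _≤_; _<_; z≤n; s≤s; _≟_; _<?_)
open import Data.Nat.Properties using (+-comm; ≤-refl; m≤n+m; m+[n∸m]≡n; ≮⇒≥; m≤n⇒m<n∨m≡n; m≤n⇒m≤1+n; suc-injective)
open import Data.Nat.Divisibility using (_∣?_; ∣m+n∣m⇒∣n; ∣m∣n⇒∣m+n; ∣-refl; >⇒∤; _∣0)
open import Data.Integer using (ℤ; +_; -[1+_]; 0ℤ; 1ℤ; +≤+) renaming (_+_ to _+ℤ_; _*_ to _*ℤ_; _-_ to _-ℤ_; -_ to -ℤ_; _≤_ to _≤ℤ_)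
import Data.Integer.Properties as ℤₚ
open import Data.Integer.Solver using (module +-*-Solver)
open import Data.Bool using (Bool; true; false; _∧_; T)
open import Data.Bool.ListAction using (all)
open import Data.Bool.Properties using (T-∧)
open import Data.List using (List; []; _∷_; _++_; [_]; foldr; replicate; applyDownFrom)
open import Data.List.Properties using (map-applyUpTo)
import Data.Maybe as Maybe
open import Data.Product using (_×_; _,_; proj₁; proj₂)
open import Data.Sum using (inj₁; inj₂)
open import Function using (_∘_)
open import Function.Bundles using (Equivalence)
open import Relation.Nullary using (yes; no; contradiction)
open import Relation.Nullary.Decidable using (dec⇒maybe)
open import Relation.Binary.Definitions using (WeaklyDecidable)
open import Relation.Binary.PropositionalEquality using (_≡_; refl; sym; trans; cong; cong₂; subst; module ≡-Reasoning)
import Relation.Binary.Reasoning.Setoid as SetoidReasoning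
open import Algebra.Bundles using (CommutativeRing; RawRing)
import Algebra.Solver.Ring as RingSolver
open import Algebra.Solver.Ring.AlmostCommutativeRing using (AlmostCommutativeRing; fromCommutativeRing; _-Raw-AlmostCommutative⟶_; Induced-equivalence)

-- The ring of formal power series

infix 4 _≋_

-- A record rather than a bare function type, so that both series can be inferred from a proof.
record _≋_ (f g : Series) : Set where
  constructor pointwise
  field at : ∀ n → f n ≡ g n

open _≋_

≋-refl : ∀ {f} → f ≋ f
≋-refl .at n = refl

≋-sym : ∀ {f g} → f ≋ g → g ≋ f
≋-sym p .at n = sym (at p n)

≋-trans : ∀ {f g h} → f ≋ g → g ≋ h → f ≋ h
≋-trans p r .at n = trans (at p n) (at r n)

zeroˢ : Series
zeroˢ _ = 0ℤ

neg : Series → Series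
neg f n = -ℤ f n

tail : Series → Series
tail f n = f (suc n)

⊕-cong : ∀ {f f′ g g′} → f ≋ f′ → g ≋ g′ → f ⊕ g ≋ f′ ⊕ g′
⊕-cong p r .at n = cong₂ _+ℤ_ (at p n) (at r n)

⊛-zero : ∀ f g → (f ⊛ g) 0 ≡ f 0 *ℤ g 0
⊛-zero f g = ℤₚ.+-identityʳ _

⊛-suc : ∀ f g n → (f ⊛ g) (suc n) ≡ f 0 *ℤ g (suc n) +ℤ (tail f ⊛ g) n
⊛-suc f g n = cong (λ l → f 0 *ℤ g (suc n) +ℤ sumℤ l)
  (trans (map-applyUpTo suc (λ i → f i *ℤ g (suc n ∸ i)) (suc n))
         (sym (map-applyUpTo (λ i → i) (λ i → f (suc i) *ℤ g (n ∸ i)) (suc n))))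

⊛-cong : ∀ {f f′ g g′} → f ≋ f′ → g ≋ g′ → f ⊛ g ≋ f′ ⊛ g′
⊛-cong {f} {f′} {g} {g′} p r .at zero = begin
  (f ⊛ g) 0       ≡⟨ ⊛-zero f g ⟩
  f 0 *ℤ g 0      ≡⟨ cong₂ _*ℤ_ (at p 0) (at r 0) ⟩
  f′ 0 *ℤ g′ 0    ≡⟨ ⊛-zero f′ g′ ⟨
  (f′ ⊛ g′) 0     ∎
  where open ≡-Reasoning
⊛-cong {f} {f′} {g} {g′} p r .at (suc n) = begin
  (f ⊛ g) (suc n)                          ≡⟨ ⊛-suc f g n ⟩
  f 0 *ℤ g (suc n) +ℤ (tail f ⊛ g) n       ≡⟨ cong₂ _+ℤ_ (cong₂ _*ℤ_ (at p 0) (at r (suc n))) (at (⊛-cong (pointwise (at p ∘ suc)) r) n) ⟩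
  f′ 0 *ℤ g′ (suc n) +ℤ (tail f′ ⊛ g′) n   ≡⟨ ⊛-suc f′ g′ n ⟨
  (f′ ⊛ g′) (suc n)                        ∎
  where open ≡-Reasoning

⊛-distribʳ : ∀ h f g → (f ⊕ g) ⊛ h ≋ f ⊛ h ⊕ g ⊛ h
⊛-distribʳ h f g .at zero = begin
  ((f ⊕ g) ⊛ h) 0               ≡⟨ ⊛-zero (f ⊕ g) h ⟩
  (f 0 +ℤ g 0) *ℤ h 0           ≡⟨ ℤₚ.*-distribʳ-+ (h 0) (f 0) (g 0) ⟩
  f 0 *ℤ h 0 +ℤ g 0 *ℤ h 0      ≡⟨ cong₂ _+ℤ_ (⊛-zero f h) (⊛-zero g h) ⟨
  (f ⊛ h) 0 +ℤ (g ⊛ h) 0        ∎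
  where open ≡-Reasoning
⊛-distribʳ h f g .at (suc n) = begin
  ((f ⊕ g) ⊛ h) (suc n)
    ≡⟨ ⊛-suc (f ⊕ g) h n ⟩
  (f 0 +ℤ g 0) *ℤ h (suc n) +ℤ ((tail f ⊕ tail g) ⊛ h) n
    ≡⟨ cong ((f 0 +ℤ g 0) *ℤ h (suc n) +ℤ_) (at (⊛-distribʳ h (tail f) (tail g)) n) ⟩
  (f 0 +ℤ g 0) *ℤ h (suc n) +ℤ ((tail f ⊛ h) n +ℤ (tail g ⊛ h) n)
    ≡⟨ solve 5 (λ a b c d e → (a :+ b) :* c :+ (d :+ e) := (a :* c :+ d) :+ (b :* c :+ e)) refl (f 0) (g 0) (h (suc n)) _ _ ⟩
  (f 0 *ℤ h (suc n) +ℤ (tail f ⊛ h) n) +ℤ (g 0 *ℤ h (suc n) +ℤ (tail g ⊛ h) n)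
    ≡⟨ cong₂ _+ℤ_ (⊛-suc f h n) (⊛-suc g h n) ⟨
  (f ⊛ h) (suc n) +ℤ (g ⊛ h) (suc n)
    ∎
  where open ≡-Reasoning; open +-*-Solver

·-⊛ : ∀ c f g → (c · f) ⊛ g ≋ c · (f ⊛ g)
·-⊛ c f g .at zero = begin
  ((c · f) ⊛ g) 0        ≡⟨ ⊛-zero (c · f) g ⟩
  c *ℤ f 0 *ℤ g 0        ≡⟨ ℤₚ.*-assoc c (f 0) (g 0) ⟩
  c *ℤ (f 0 *ℤ g 0)      ≡⟨ cong (c *ℤ_) (⊛-zero f g) ⟨
  c *ℤ (f ⊛ g) 0         ∎
  where open ≡-Reasoning
·-⊛ c f g .at (suc n) = begin
  ((c · f) ⊛ g) (suc n)
    ≡⟨ ⊛-suc (c · f) g n ⟩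
  c *ℤ f 0 *ℤ g (suc n) +ℤ ((c · tail f) ⊛ g) n
    ≡⟨ cong (c *ℤ f 0 *ℤ g (suc n) +ℤ_) (at (·-⊛ c (tail f) g) n) ⟩
  c *ℤ f 0 *ℤ g (suc n) +ℤ c *ℤ (tail f ⊛ g) n
    ≡⟨ solve 4 (λ a b d e → a :* b :* d :+ a :* e := a :* (b :* d :+ e)) refl c (f 0) (g (suc n)) _ ⟩
  c *ℤ (f 0 *ℤ g (suc n) +ℤ (tail f ⊛ g) n)
    ≡⟨ cong (c *ℤ_) (⊛-suc f g n) ⟨
  c *ℤ (f ⊛ g) (suc n)
    ∎
  where open ≡-Reasoning; open +-*-Solver

-- The recursion of `⊛-suc` from the other end of the sum; matching the two yields commutativity.
⊛-suc′ : ∀ f g n → (f ⊛ g) (suc n) ≡ f (suc n) *ℤ g 0 +ℤ (f ⊛ tail g) n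
⊛-suc′ f g zero = begin
  (f ⊛ g) 1                              ≡⟨ ⊛-suc f g 0 ⟩
  f 0 *ℤ g 1 +ℤ (tail f ⊛ g) 0           ≡⟨ cong (f 0 *ℤ g 1 +ℤ_) (⊛-zero (tail f) g) ⟩
  f 0 *ℤ g 1 +ℤ f 1 *ℤ g 0               ≡⟨ ℤₚ.+-comm (f 0 *ℤ g 1) (f 1 *ℤ g 0) ⟩
  f 1 *ℤ g 0 +ℤ f 0 *ℤ g 1               ≡⟨ cong (f 1 *ℤ g 0 +ℤ_) (⊛-zero f (tail g)) ⟨
  f 1 *ℤ g 0 +ℤ (f ⊛ tail g) 0           ∎
  where open ≡-Reasoning
⊛-suc′ f g (suc n) = begin
  (f ⊛ g) (suc (suc n))
    ≡⟨ ⊛-suc f g (suc n) ⟩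
  f 0 *ℤ g (suc (suc n)) +ℤ (tail f ⊛ g) (suc n)
    ≡⟨ cong (f 0 *ℤ g (suc (suc n)) +ℤ_) (⊛-suc′ (tail f) g n) ⟩
  f 0 *ℤ g (suc (suc n)) +ℤ (f (suc (suc n)) *ℤ g 0 +ℤ (tail f ⊛ tail g) n)
    ≡⟨ solve 3 (λ a b c → a :+ (b :+ c) := b :+ (a :+ c)) refl (f 0 *ℤ g (suc (suc n))) (f (suc (suc n)) *ℤ g 0) _ ⟩
  f (suc (suc n)) *ℤ g 0 +ℤ (f 0 *ℤ g (suc (suc n)) +ℤ (tail f ⊛ tail g) n)
    ≡⟨ cong (f (suc (suc n)) *ℤ g 0 +ℤ_) (⊛-suc f (tail g) n) ⟨
  f (suc (suc n)) *ℤ g 0 +ℤ (f ⊛ tail g) (suc n)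
    ∎
  where open ≡-Reasoning; open +-*-Solver

⊛-comm : ∀ f g → f ⊛ g ≋ g ⊛ f
⊛-comm f g .at zero = begin
  (f ⊛ g) 0     ≡⟨ ⊛-zero f g ⟩
  f 0 *ℤ g 0    ≡⟨ ℤₚ.*-comm (f 0) (g 0) ⟩
  g 0 *ℤ f 0    ≡⟨ ⊛-zero g f ⟨
  (g ⊛ f) 0     ∎
  where open ≡-Reasoning
⊛-comm f g .at (suc n) = begin
  (f ⊛ g) (suc n)                      ≡⟨ ⊛-suc f g n ⟩
  f 0 *ℤ g (suc n) +ℤ (tail f ⊛ g) n   ≡⟨ cong₂ _+ℤ_ (ℤₚ.*-comm (f 0) (g (suc n))) (at (⊛-comm (tail f) g) n) ⟩
  g (suc n) *ℤ f 0 +ℤ (g ⊛ tail f) n   ≡⟨ ⊛-suc′ g f n ⟨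
  (g ⊛ f) (suc n)                      ∎
  where open ≡-Reasoning

⊛-assoc : ∀ f g h → (f ⊛ g) ⊛ h ≋ f ⊛ (g ⊛ h)
⊛-assoc f g h .at zero = begin
  ((f ⊛ g) ⊛ h) 0          ≡⟨ ⊛-zero (f ⊛ g) h ⟩
  (f ⊛ g) 0 *ℤ h 0         ≡⟨ cong (_*ℤ h 0) (⊛-zero f g) ⟩
  f 0 *ℤ g 0 *ℤ h 0        ≡⟨ ℤₚ.*-assoc (f 0) (g 0) (h 0) ⟩
  f 0 *ℤ (g 0 *ℤ h 0)      ≡⟨ cong (f 0 *ℤ_) (⊛-zero g h) ⟨
  f 0 *ℤ (g ⊛ h) 0         ≡⟨ ⊛-zero f (g ⊛ h) ⟨
  (f ⊛ (g ⊛ h)) 0          ∎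
  where open ≡-Reasoning
⊛-assoc f g h .at (suc n) = begin
  ((f ⊛ g) ⊛ h) (suc n)
    ≡⟨ ⊛-suc (f ⊛ g) h n ⟩
  (f ⊛ g) 0 *ℤ h (suc n) +ℤ (tail (f ⊛ g) ⊛ h) n
    ≡⟨ cong₂ (λ a b → a *ℤ h (suc n) +ℤ b) (⊛-zero f g) tail-⊛ ⟩
  f 0 *ℤ g 0 *ℤ h (suc n) +ℤ (f 0 *ℤ (tail g ⊛ h) n +ℤ (tail f ⊛ (g ⊛ h)) n)
    ≡⟨ solve 5 (λ a b c d e → a :* b :* c :+ (a :* d :+ e) := a :* (b :* c :+ d) :+ e) refl (f 0) (g 0) (h (suc n)) _ _ ⟩
  f 0 *ℤ (g 0 *ℤ h (suc n) +ℤ (tail g ⊛ h) n) +ℤ (tail f ⊛ (g ⊛ h)) n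
    ≡⟨ cong (λ a → f 0 *ℤ a +ℤ (tail f ⊛ (g ⊛ h)) n) (⊛-suc g h n) ⟨
  f 0 *ℤ (g ⊛ h) (suc n) +ℤ (tail f ⊛ (g ⊛ h)) n
    ≡⟨ ⊛-suc f (g ⊛ h) n ⟨
  (f ⊛ (g ⊛ h)) (suc n)
    ∎
  where
  open ≡-Reasoning; open +-*-Solver
  -- By `⊛-suc` the tail of a product is `f 0 · tail g ⊕ tail f ⊛ g`; the induction hypothesis is
  -- then needed for `tail f` in place of `f`.
  tail-⊛ : (tail (f ⊛ g) ⊛ h) n ≡ f 0 *ℤ (tail g ⊛ h) n +ℤ (tail f ⊛ (g ⊛ h)) n
  tail-⊛ = begin
    (tail (f ⊛ g) ⊛ h) n                              ≡⟨ at (⊛-cong {g = h} (pointwise (⊛-suc f g)) ≋-refl) n ⟩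
    ((f 0 · tail g ⊕ tail f ⊛ g) ⊛ h) n               ≡⟨ at (⊛-distribʳ h (f 0 · tail g) (tail f ⊛ g)) n ⟩
    ((f 0 · tail g) ⊛ h) n +ℤ ((tail f ⊛ g) ⊛ h) n    ≡⟨ cong₂ _+ℤ_ (at (·-⊛ (f 0) (tail g) h) n) (at (⊛-assoc (tail f) g h) n) ⟩
    f 0 *ℤ (tail g ⊛ h) n +ℤ (tail f ⊛ (g ⊛ h)) n     ∎

⊛-zeroˡ : ∀ f → zeroˢ ⊛ f ≋ zeroˢ
⊛-zeroˡ f .at zero = refl
⊛-zeroˡ f .at (suc n) = trans (⊛-suc zeroˢ f n) (trans (ℤₚ.+-identityˡ _) (at (⊛-zeroˡ f) n))

⊛-identityˡ : ∀ f → one ⊛ f ≋ f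
⊛-identityˡ f .at zero = trans (⊛-zero one f) (ℤₚ.*-identityˡ (f 0))
⊛-identityˡ f .at (suc n) = begin
  (one ⊛ f) (suc n)                     ≡⟨ ⊛-suc one f n ⟩
  1ℤ *ℤ f (suc n) +ℤ (zeroˢ ⊛ f) n      ≡⟨ cong₂ _+ℤ_ (ℤₚ.*-identityˡ (f (suc n))) (at (⊛-zeroˡ f) n) ⟩
  f (suc n) +ℤ 0ℤ                       ≡⟨ ℤₚ.+-identityʳ (f (suc n)) ⟩
  f (suc n)                             ∎
  where open ≡-Reasoning

seriesRing : CommutativeRing _ _
seriesRing = record
  { Carrier = Series ; _≈_ = _≋_ ; _+_ = _⊕_ ; _*_ = _⊛_ ; -_ = neg ; 0# = zeroˢ ; 1# = one
  ; isCommutativeRing = record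
    { isRing = record
      { +-isAbelianGroup = record
        { isGroup = record
          { isMonoid = record
            { isSemigroup = record
              { isMagma = record
                { isEquivalence = record { refl = ≋-refl ; sym = ≋-sym ; trans = ≋-trans }
                ; ∙-cong = ⊕-cong }
              ; assoc = λ f g h → pointwise λ n → ℤₚ.+-assoc (f n) (g n) (h n) }
            ; identity = (λ f → pointwise λ n → ℤₚ.+-identityˡ (f n))
                       , (λ f → pointwise λ n → ℤₚ.+-identityʳ (f n)) }
          ; inverse = (λ f → pointwise λ n → ℤₚ.+-inverseˡ (f n))
                    , (λ f → pointwise λ n → ℤₚ.+-inverseʳ (f n))
          ; ⁻¹-cong = λ p → pointwise λ n → cong -ℤ_ (at p n) }
        ; comm = λ f g → pointwise λ n → ℤₚ.+-comm (f n) (g n) }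
      ; *-cong = ⊛-cong
      ; *-assoc = ⊛-assoc
      ; *-identity = ⊛-identityˡ , (λ f → ≋-trans (⊛-comm f one) (⊛-identityˡ f))
      ; distrib = (λ h f g → ≋-trans (⊛-comm h (f ⊕ g))
                    (≋-trans (⊛-distribʳ h f g) (⊕-cong (⊛-comm f h) (⊛-comm g h))))
                , ⊛-distribʳ }
    ; *-comm = ⊛-comm } }

open CommutativeRing seriesRing using () renaming (setoid to seriesSetoid)

seriesACR : AlmostCommutativeRing _ _
seriesACR = fromCommutativeRing seriesRing

-- A ring solver for power series

ℤ-rawRing : RawRing _ _
ℤ-rawRing = CommutativeRing.rawRing ℤₚ.+-*-commutativeRing

-- Solver coefficients are integers because their equality is decidable, which lets like terms
-- cancel; equality of series is not.
constants : ℤ-rawRing -Raw-AlmostCommutative⟶ seriesACR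
constants = record
  { ⟦_⟧ = _· one
  ; +-homo = λ a b → pointwise λ n → ℤₚ.*-distribʳ-+ (one n) a b
  ; *-homo = λ a b → ≋-sym (≋-trans (·-⊛ a one (b · one)) (pointwise λ n →
      trans (cong (a *ℤ_) (at (⊛-identityˡ (b · one)) n)) (sym (ℤₚ.*-assoc a b (one n)))))
  ; -‿homo = λ a → pointwise λ n → sym (ℤₚ.neg-distribˡ-* a (one n))
  ; 0-homo = pointwise λ n → refl
  ; 1-homo = pointwise λ n → ℤₚ.*-identityˡ (one n)
  }

constant≟ : WeaklyDecidable (Induced-equivalence constants)
constant≟ a b = Maybe.map (λ e → pointwise λ n → cong (_*ℤ one n) e) (dec⇒maybe (a ℤₚ.≟ b))

module SeriesSolver = RingSolver ℤ-rawRing seriesACR constants constant≟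
open SeriesSolver using (Polynomial; solve; con; _:+_; _:*_; _:-_; _:=_)

⊕-congˡ : ∀ f {g g′} → g ≋ g′ → f ⊕ g ≋ f ⊕ g′
⊕-congˡ f p .at n = cong (f n +ℤ_) (at p n)

⊕-congʳ : ∀ g {f f′} → f ≋ f′ → f ⊕ g ≋ f′ ⊕ g
⊕-congʳ g p = ⊕-cong p (≋-refl {g})

⊖-cong : ∀ {f f′ g g′} → f ≋ f′ → g ≋ g′ → f ⊖ g ≋ f′ ⊖ g′
⊖-cong p r .at n = cong₂ _-ℤ_ (at p n) (at r n)

⊖-congˡ : ∀ f {g g′} → g ≋ g′ → f ⊖ g ≋ f ⊖ g′
⊖-congˡ f p = ⊖-cong (≋-refl {f}) p

⊖-congʳ : ∀ g {f f′} → f ≋ f′ → f ⊖ g ≋ f′ ⊖ g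
⊖-congʳ g p = ⊖-cong p (≋-refl {g})

⊛-congˡ : ∀ f {g g′} → g ≋ g′ → f ⊛ g ≋ f ⊛ g′
⊛-congˡ f p = ⊛-cong (≋-refl {f}) p

⊛-congʳ : ∀ g {f f′} → f ≋ f′ → f ⊛ g ≋ f′ ⊛ g
⊛-congʳ g p = ⊛-cong p (≋-refl {g})

-- Non-negative coefficients

record Nonneg (f : Series) : Set where
  constructor nonneg
  field coeff : ∀ n → 0ℤ ≤ℤ f n

open Nonneg

Nonneg-resp : ∀ {f g} → f ≋ g → Nonneg f → Nonneg g
Nonneg-resp p f≥0 .coeff n = subst (0ℤ ≤ℤ_) (at p n) (coeff f≥0 n)

0≤+ : ∀ {a b} → 0ℤ ≤ℤ a → 0ℤ ≤ℤ b → 0ℤ ≤ℤ a +ℤ b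
0≤+ = ℤₚ.+-mono-≤

0≤* : ∀ {a b} → 0ℤ ≤ℤ a → 0ℤ ≤ℤ b → 0ℤ ≤ℤ a *ℤ b
0≤* {+ m} {+ n} _ _ = subst (0ℤ ≤ℤ_) (ℤₚ.pos-* m n) (+≤+ z≤n)

Nonneg-⊕ : ∀ {f g} → Nonneg f → Nonneg g → Nonneg (f ⊕ g)
Nonneg-⊕ f≥0 g≥0 .coeff n = 0≤+ (coeff f≥0 n) (coeff g≥0 n)

Nonneg-⊛ : ∀ {f g} → Nonneg f → Nonneg g → Nonneg (f ⊛ g)
Nonneg-⊛ {f} {g} f≥0 g≥0 .coeff zero =
  subst (0ℤ ≤ℤ_) (sym (⊛-zero f g)) (0≤* (coeff f≥0 0) (coeff g≥0 0))
Nonneg-⊛ {f} {g} f≥0 g≥0 .coeff (suc n) =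
  subst (0ℤ ≤ℤ_) (sym (⊛-suc f g n))
    (0≤+ (0≤* (coeff f≥0 0) (coeff g≥0 (suc n))) (coeff (Nonneg-⊛ (nonneg (coeff f≥0 ∘ suc)) g≥0) n))

-- Powers of q

δ-suc : ∀ m n → δ (suc m) (suc n) ≡ δ m n
δ-suc m n with suc m ≟ suc n | m ≟ n
... | yes _ | yes _ = refl
... | no _  | no _  = refl
... | yes e | no ¬e = contradiction (suc-injective e) ¬e
... | no ¬e | yes e = contradiction (cong suc e) ¬e

δ-nonneg : ∀ m n → 0ℤ ≤ℤ δ m n
δ-nonneg m n with m ≟ n
... | yes _ = +≤+ z≤n
... | no _  = +≤+ z≤n

q^-⊛-zero : ∀ k f → (q^ (suc k) ⊛ f) 0 ≡ 0ℤ
q^-⊛-zero k f = ⊛-zero (q^ (suc k)) f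

q^-⊛-suc : ∀ k f n → (q^ (suc k) ⊛ f) (suc n) ≡ (q^ k ⊛ f) n
q^-⊛-suc k f n = begin
  (q^ (suc k) ⊛ f) (suc n)           ≡⟨ ⊛-suc (q^ (suc k)) f n ⟩
  0ℤ +ℤ (tail (q^ (suc k)) ⊛ f) n    ≡⟨ ℤₚ.+-identityˡ _ ⟩
  (tail (q^ (suc k)) ⊛ f) n          ≡⟨ at (⊛-congʳ f (pointwise λ i → δ-suc i k)) n ⟩
  (q^ k ⊛ f) n                       ∎
  where open ≡-Reasoning

q^-⊛-+ : ∀ k f n → (q^ k ⊛ f) (k + n) ≡ f n
q^-⊛-+ zero    f n = at (⊛-identityˡ f) n
q^-⊛-+ (suc k) f n = trans (q^-⊛-suc k f (k + n)) (q^-⊛-+ k f n)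

q^-⊛-< : ∀ {k n} f → n < k → (q^ k ⊛ f) n ≡ 0ℤ
q^-⊛-< {suc k} {zero}  f _         = q^-⊛-zero k f
q^-⊛-< {suc k} {suc n} f (s≤s n<k) = trans (q^-⊛-suc k f n) (q^-⊛-< f n<k)

q^-suc : ∀ k → q^ 1 ⊛ q^ k ≋ q^ (suc k)
q^-suc k .at zero    = q^-⊛-zero 0 (q^ k)
q^-suc k .at (suc n) = trans (q^-⊛-+ 1 (q^ k) n) (sym (δ-suc n k))

-- The constant is 1ℤ · one rather than one because that is how the ring solver evaluates constants.
X^ : ℕ → Series
X^ zero    = 1ℤ · one
X^ (suc k) = q^ 1 ⊛ X^ k

q^≋X^ : ∀ k → q^ k ≋ X^ k
q^≋X^ zero    .at n = sym (ℤₚ.*-identityˡ (one n))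
q^≋X^ (suc k) = ≋-trans (≋-sym (q^-suc k)) (⊛-congˡ (q^ 1) (q^≋X^ k))

Nonneg-X^ : ∀ k → Nonneg (X^ k)
Nonneg-X^ k = Nonneg-resp (q^≋X^ k) (nonneg λ n → δ-nonneg n k)

-- Coefficient `n` of the product involves no coefficient of `f` beyond `n`, as strong induction
-- requires.
q^-⊛-nonneg : ∀ k n {f} → (∀ m → m ≤ n → 0ℤ ≤ℤ f m) → 0ℤ ≤ℤ (q^ k ⊛ f) n
q^-⊛-nonneg zero    n {f} f≥0 = subst (0ℤ ≤ℤ_) (sym (at (⊛-identityˡ f) n)) (f≥0 n ≤-refl)
q^-⊛-nonneg (suc k) zero {f} f≥0 = ℤₚ.≤-reflexive (sym (q^-⊛-zero k f))
q^-⊛-nonneg (suc k) (suc n) {f} f≥0 =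
  subst (0ℤ ≤ℤ_) (sym (q^-⊛-suc k f n)) (q^-⊛-nonneg k n (λ m m≤n → f≥0 m (m≤n⇒m≤1+n m≤n)))

-- Since f = (1 - q^(k+1)) f + q^(k+1) f, each coefficient of f is a non-negative number plus either
-- zero or an earlier coefficient of f.
Nonneg-cancel : ∀ k {f} → Nonneg ((X^ 0 ⊖ X^ (suc k)) ⊛ f) → Nonneg f
Nonneg-cancel k {f} g≥0 .coeff n = upTo n n ≤-refl
  where
  split : f ≋ (X^ 0 ⊖ X^ (suc k)) ⊛ f ⊕ q^ (suc k) ⊛ f
  split = ≋-trans
    (solve 2 (λ y f → f := (con 1ℤ :- y) :* f :+ y :* f) ≋-refl (X^ (suc k)) f)
    (⊕-congˡ ((X^ 0 ⊖ X^ (suc k)) ⊛ f) (⊛-congʳ f (≋-sym (q^≋X^ (suc k)))))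
  upTo : ∀ n m → m ≤ n → 0ℤ ≤ℤ f m
  upTo zero zero _ = subst (0ℤ ≤ℤ_) (sym (at split 0))
    (0≤+ (coeff g≥0 0) (ℤₚ.≤-reflexive (sym (q^-⊛-zero k f))))
  upTo (suc n) m m≤1+n with m≤n⇒m<n∨m≡n m≤1+n
  ... | inj₁ (s≤s m≤n) = upTo n m m≤n
  ... | inj₂ refl = subst (0ℤ ≤ℤ_) (sym (at split (suc n)))
    (0≤+ (coeff g≥0 (suc n)) (subst (0ℤ ≤ℤ_) (sym (q^-⊛-suc k f n)) (q^-⊛-nonneg k n (upTo n))))

-- Geometric series and partition products

geom-+ : ∀ k n → geom k (suc k + n) ≡ geom k n
geom-+ k n with suc k ∣? suc k + n | suc k ∣? n
... | yes _ | yes _ = refl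
... | no _  | no _  = refl
... | yes p | no ¬p = contradiction (∣m+n∣m⇒∣n p ∣-refl) ¬p
... | no ¬p | yes p = contradiction (∣m∣n⇒∣m+n ∣-refl p) ¬p

geom-< : ∀ k n → n < suc k → geom k n ≡ one n
geom-< k zero    _ with suc k ∣? 0
... | yes _ = refl
... | no ¬p = contradiction (suc k ∣0) ¬p
geom-< k (suc n) n<k with suc k ∣? suc n
... | yes p = contradiction p (>⇒∤ n<k)
... | no _  = refl

geom-nonneg : ∀ k → Nonneg (geom k)
geom-nonneg k .coeff n with suc k ∣? n
... | yes _ = +≤+ z≤n
... | no _  = +≤+ z≤n

-- Below index k + 1 the shifted copy vanishes; from there on `one` vanishes and divisibility is
-- periodic.
geom-unfold : ∀ k → geom k ≋ one ⊕ q^ (suc k) ⊛ geom k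
geom-unfold k .at n with n <? suc k
... | yes n<k = begin
  geom k n                                ≡⟨ geom-< k n n<k ⟩
  one n                                   ≡⟨ ℤₚ.+-identityʳ (one n) ⟨
  one n +ℤ 0ℤ                             ≡⟨ cong (one n +ℤ_) (q^-⊛-< (geom k) n<k) ⟨
  one n +ℤ (q^ (suc k) ⊛ geom k) n        ∎
  where open ≡-Reasoning
... | no n≮k = subst (λ i → geom k i ≡ one i +ℤ (q^ (suc k) ⊛ geom k) i) (m+[n∸m]≡n (≮⇒≥ n≮k)) (begin
  geom k (suc k + r)                                      ≡⟨ geom-+ k r ⟩
  geom k r                                                ≡⟨ q^-⊛-+ (suc k) (geom k) r ⟨
  (q^ (suc k) ⊛ geom k) (suc k + r)                       ≡⟨ ℤₚ.+-identityˡ _ ⟨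
  one (suc k + r) +ℤ (q^ (suc k) ⊛ geom k) (suc k + r)    ∎)
  where
  open ≡-Reasoning
  r = n ∸ suc k

geom-inverse : ∀ k f → (X^ 0 ⊖ X^ (suc k)) ⊛ (f ⊛ geom k) ≋ f
geom-inverse k f = begin
  (X^ 0 ⊖ X^ (suc k)) ⊛ (f ⊛ geom k)
    ≈⟨ solve 3 (λ y f g → (con 1ℤ :- y) :* (f :* g) := f :* (g :- y :* g)) ≋-refl (X^ (suc k)) f (geom k) ⟩
  f ⊛ (geom k ⊖ X^ (suc k) ⊛ geom k)
    ≈⟨ ⊛-congˡ f (⊖-congʳ (X^ (suc k) ⊛ geom k) unfold) ⟩
  f ⊛ (X^ 0 ⊕ X^ (suc k) ⊛ geom k ⊖ X^ (suc k) ⊛ geom k)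
    ≈⟨ solve 3 (λ y f g → f :* (con 1ℤ :+ y :* g :- y :* g) := f) ≋-refl (X^ (suc k)) f (geom k) ⟩
  f ∎
  where
  open SetoidReasoning seriesSetoid
  unfold : geom k ≋ X^ 0 ⊕ X^ (suc k) ⊛ geom k
  unfold = ≋-trans (geom-unfold k) (⊕-cong (q^≋X^ 0) (⊛-congʳ (geom k) (q^≋X^ (suc k))))

U : ℕ → Series
U = invPochSuc 1

U-pred : ∀ n → U n ≋ (X^ 0 ⊖ X^ (2 + n)) ⊛ U (suc n)
U-pred n = ≋-sym (geom-inverse (1 + n) (U n))

U-nonneg : ∀ n → Nonneg (U n)
U-nonneg zero    = nonneg λ n → δ-nonneg n 0
U-nonneg (suc n) = Nonneg-⊛ (U-nonneg n) (geom-nonneg (1 + n))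

-- The factor cancels the part 2 + j, leaving partitions into the other parts. The induction strips
-- larger parts until 2 + j is the largest.
omit-part : ∀ {j n} → j < n → Nonneg ((X^ 0 ⊖ X^ (2 + j)) ⊛ U n)
omit-part {j} {suc n} (s≤s j≤n) with m≤n⇒m<n∨m≡n j≤n
... | inj₂ refl = Nonneg-resp (U-pred j) (U-nonneg j)
... | inj₁ j<n = Nonneg-resp (⊛-assoc (X^ 0 ⊖ X^ (2 + j)) (U n) (geom (1 + n)))
                   (Nonneg-⊛ (omit-part j<n) (geom-nonneg (1 + n)))

-- Starting at q³ rather than q² omits the part 2. This brings both quotients in `H` over one
-- denominator.
remove-smallest-part : ∀ n → invPochSuc 2 n ≋ (X^ 0 ⊖ X^ 2) ⊛ U (suc n)
remove-smallest-part zero = ≋-sym (geom-inverse 1 one)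
remove-smallest-part (suc n) = ≋-trans
  (⊛-congʳ (geom (2 + n)) (remove-smallest-part n))
  (⊛-assoc (X^ 0 ⊖ X^ 2) (U (suc n)) (geom (2 + n)))

-- Certificates for rational functions with fixed denominator

Poly : Set
Poly = List ℤ

⟦_⟧ : Poly → Series
⟦ [] ⟧    n       = 0ℤ
⟦ c ∷ p ⟧ zero    = c
⟦ c ∷ p ⟧ (suc n) = ⟦ p ⟧ n

infixl 6 _⊞_ _⊟_

_⊞_ : Poly → Poly → Poly
[]      ⊞ r       = r
(c ∷ p) ⊞ []      = c ∷ p
(c ∷ p) ⊞ (d ∷ r) = c +ℤ d ∷ p ⊞ r

_⊟_ : Poly → Poly → Poly
p       ⊟ []      = p
[]      ⊟ (d ∷ r) = 0ℤ -ℤ d ∷ [] ⊟ r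
(c ∷ p) ⊟ (d ∷ r) = c -ℤ d ∷ p ⊟ r

shift : ℕ → Poly → Poly
shift k p = replicate k 0ℤ ++ p

⟦⊞⟧ : ∀ p r → ⟦ p ⊞ r ⟧ ≋ ⟦ p ⟧ ⊕ ⟦ r ⟧
⟦⊞⟧ []      r       .at n       = sym (ℤₚ.+-identityˡ _)
⟦⊞⟧ (c ∷ p) []      .at n       = sym (ℤₚ.+-identityʳ _)
⟦⊞⟧ (c ∷ p) (d ∷ r) .at zero    = refl
⟦⊞⟧ (c ∷ p) (d ∷ r) .at (suc n) = at (⟦⊞⟧ p r) n

⟦⊟⟧ : ∀ p r → ⟦ p ⊟ r ⟧ ≋ ⟦ p ⟧ ⊖ ⟦ r ⟧
⟦⊟⟧ []      []      .at n       = refl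
⟦⊟⟧ (c ∷ p) []      .at n       = sym (ℤₚ.+-identityʳ _)
⟦⊟⟧ []      (d ∷ r) .at zero    = refl
⟦⊟⟧ []      (d ∷ r) .at (suc n) = at (⟦⊟⟧ [] r) n
⟦⊟⟧ (c ∷ p) (d ∷ r) .at zero    = refl
⟦⊟⟧ (c ∷ p) (d ∷ r) .at (suc n) = at (⟦⊟⟧ p r) n

⟦shift⟧ : ∀ k p → ⟦ shift k p ⟧ ≋ X^ k ⊛ ⟦ p ⟧
⟦shift⟧ zero    p = solve 1 (λ p → p := con 1ℤ :* p) ≋-refl ⟦ p ⟧
⟦shift⟧ (suc k) p = ≋-trans cons
  (≋-trans (⊛-congˡ (q^ 1) (⟦shift⟧ k p)) (≋-sym (⊛-assoc (q^ 1) (X^ k) ⟦ p ⟧)))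
  where
  cons : ⟦ 0ℤ ∷ shift k p ⟧ ≋ q^ 1 ⊛ ⟦ shift k p ⟧
  cons .at zero    = sym (q^-⊛-zero 0 ⟦ shift k p ⟧)
  cons .at (suc n) = sym (q^-⊛-+ 1 ⟦ shift k p ⟧ n)

times1-X^ : ℕ → Poly → Poly
times1-X^ k p = p ⊟ shift k p

⟦times1-X^⟧ : ∀ k p → ⟦ times1-X^ k p ⟧ ≋ (X^ 0 ⊖ X^ k) ⊛ ⟦ p ⟧
⟦times1-X^⟧ k p = ≋-trans (⟦⊟⟧ p (shift k p)) (≋-trans (⊖-congˡ ⟦ p ⟧ (⟦shift⟧ k p))
  (solve 2 (λ y p → p :- y :* p := (con 1ℤ :- y) :* p) ≋-refl (X^ k) ⟦ p ⟧))

-- An entry d stands for the factor 1 - q^(d+1), as in geom.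
denominator : List ℕ → Series
denominator []       = X^ 0
denominator (d ∷ ds) = (X^ 0 ⊖ X^ (suc d)) ⊛ denominator ds

timesDenominator : List ℕ → Poly → Poly
timesDenominator ds p = foldr (λ d → times1-X^ (suc d)) p ds

⟦timesDenominator⟧ : ∀ ds p → ⟦ timesDenominator ds p ⟧ ≋ denominator ds ⊛ ⟦ p ⟧
⟦timesDenominator⟧ []       p = solve 1 (λ p → p := con 1ℤ :* p) ≋-refl ⟦ p ⟧
⟦timesDenominator⟧ (d ∷ ds) p = ≋-trans (⟦times1-X^⟧ (suc d) (timesDenominator ds p))
  (≋-trans (⊛-congˡ (X^ 0 ⊖ X^ (suc d)) (⟦timesDenominator⟧ ds p))
    (≋-sym (⊛-assoc (X^ 0 ⊖ X^ (suc d)) (denominator ds) ⟦ p ⟧)))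

Nonneg-cancel-denominator : ∀ ds {f} → Nonneg (denominator ds ⊛ f) → Nonneg f
Nonneg-cancel-denominator [] {f} = Nonneg-resp (solve 1 (λ f → con 1ℤ :* f := f) ≋-refl f)
Nonneg-cancel-denominator (d ∷ ds) {f} f≥0 = Nonneg-cancel-denominator ds
  (Nonneg-cancel d (Nonneg-resp (⊛-assoc (X^ 0 ⊖ X^ (suc d)) (denominator ds) f) f≥0))

-- The buffer holds the preceding d + 1 coefficients of the quotient by 1 - q^(d+1).  The soundness
-- of check does not depend on the result being the true quotient.
mutual
  divide1-X^ : ℕ → Poly → Poly → Poly
  divide1-X^ (suc t) (b ∷ buffer) []      = emit t buffer [] b
  divide1-X^ (suc t) (b ∷ buffer) (c ∷ p) = emit t buffer p (b +ℤ c)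
  divide1-X^ _       _            _       = []

  emit : ℕ → Poly → Poly → ℤ → Poly
  emit t buffer p c = c ∷ divide1-X^ t (buffer ++ [ c ]) p

-- Cutting every intermediate quotient after `t` terms is harmless, since its coefficients below `t`
-- depend only on those of the dividend below `t`.
firstCoefficients : ℕ → List ℕ → Poly → Poly
firstCoefficients t ds p = foldr (λ d → divide1-X^ t (replicate (suc d) 0ℤ)) p ds

isNonneg : ℤ → Bool
isNonneg (+ _)    = true
isNonneg -[1+ _ ] = false

⟦⟧-nonneg : ∀ p → T (all isNonneg p) → Nonneg ⟦ p ⟧
⟦⟧-nonneg []          _  .coeff n       = +≤+ z≤n
⟦⟧-nonneg (+ c ∷ p)   ok .coeff zero    = +≤+ z≤n
⟦⟧-nonneg (+ c ∷ p)   ok .coeff (suc n) = coeff (⟦⟧-nonneg p ok) n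

-- A step (t , a) removes the first t coefficients and multiplies the rest by 1 - q^(a+1).
-- checkStep takes these coefficients as an argument so that they are evaluated only once.
mutual
  check : List ℕ → Poly → List (ℕ × ℕ) → Bool
  check ds p []               = all isNonneg p
  check ds p ((t , a) ∷ steps) = checkStep ds p a steps (firstCoefficients t ds p)

  checkStep : List ℕ → Poly → ℕ → List (ℕ × ℕ) → Poly → Bool
  checkStep ds p a steps r =
    all isNonneg r ∧ check ds (times1-X^ (suc a) (p ⊟ timesDenominator ds r)) steps

-- The invariant is that `p` is the numerator of the current `f` over the fixed denominator. A step
-- passes to (1 - q^(a+1)) (f - r), which changes only the numerator.
check-sound : ∀ ds p steps → T (check ds p steps) → ∀ {f} → denominator ds ⊛ f ≋ ⟦ p ⟧ → Nonneg f
check-sound ds p [] ok eq = Nonneg-cancel-denominator ds (Nonneg-resp (≋-sym eq) (⟦⟧-nonneg p ok))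
check-sound ds p ((t , a) ∷ steps) ok {f} eq =
  Nonneg-resp (solve 2 (λ r f → r :+ (f :- r) := f) ≋-refl ⟦ r ⟧ f)
    (Nonneg-⊕ (⟦⟧-nonneg r (proj₁ oks))
      (Nonneg-cancel a (check-sound ds (times1-X^ (suc a) (p ⊟ timesDenominator ds r)) steps (proj₂ oks) eq′)))
  where
  r = firstCoefficients t ds p
  oks = Equivalence.to T-∧ ok
  D = denominator ds
  y = X^ (suc a)
  open SetoidReasoning seriesSetoid
  eq′ : D ⊛ ((X^ 0 ⊖ y) ⊛ (f ⊖ ⟦ r ⟧)) ≋ ⟦ times1-X^ (suc a) (p ⊟ timesDenominator ds r) ⟧
  eq′ = begin
    D ⊛ ((X^ 0 ⊖ y) ⊛ (f ⊖ ⟦ r ⟧))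
      ≈⟨ solve 4 (λ D y f r → D :* ((con 1ℤ :- y) :* (f :- r)) := (con 1ℤ :- y) :* (D :* f :- D :* r)) ≋-refl D y f ⟦ r ⟧ ⟩
    (X^ 0 ⊖ y) ⊛ (D ⊛ f ⊖ D ⊛ ⟦ r ⟧)
      ≈⟨ ⊛-congˡ (X^ 0 ⊖ y) (⊖-cong eq (≋-sym (⟦timesDenominator⟧ ds r))) ⟩
    (X^ 0 ⊖ y) ⊛ (⟦ p ⟧ ⊖ ⟦ timesDenominator ds r ⟧)
      ≈⟨ ⊛-congˡ (X^ 0 ⊖ y) (≋-sym (⟦⊟⟧ p (timesDenominator ds r))) ⟩
    (X^ 0 ⊖ y) ⊛ ⟦ p ⊟ timesDenominator ds r ⟧
      ≈⟨ ⟦times1-X^⟧ (suc a) (p ⊟ timesDenominator ds r) ⟨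
    ⟦ times1-X^ (suc a) (p ⊟ timesDenominator ds r) ⟧
      ∎

-- Certificates for lower bounds

infixl 6 _⊞ᵉ_ _⊟ᵉ_

-- Syntax with two readings: as a series, for identities with symbolic exponents, and as a
-- coefficient list, for computation.
data Expr : Set where
  mono      : ℕ → Expr
  _⊞ᵉ_ _⊟ᵉ_ : Expr → Expr → Expr

series : Expr → Series
series (mono k) = X^ k
series (e ⊞ᵉ f) = series e ⊕ series f
series (e ⊟ᵉ f) = series e ⊖ series f

poly : Expr → Poly
poly (mono k) = shift k (1ℤ ∷ [])
poly (e ⊞ᵉ f) = poly e ⊞ poly f
poly (e ⊟ᵉ f) = poly e ⊟ poly f

⟦poly⟧ : ∀ e → ⟦ poly e ⟧ ≋ series e
⟦poly⟧ (mono k) = ≋-trans (⟦shift⟧ k (1ℤ ∷ [])) (≋-trans (⊛-congˡ (X^ k) 1≋X^0)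
  (solve 1 (λ x → x :* con 1ℤ := x) ≋-refl (X^ k)))
  where
  1≋X^0 : ⟦ 1ℤ ∷ [] ⟧ ≋ X^ 0
  1≋X^0 .at zero    = refl
  1≋X^0 .at (suc n) = refl
⟦poly⟧ (e ⊞ᵉ f) = ≋-trans (⟦⊞⟧ (poly e) (poly f)) (⊕-cong (⟦poly⟧ e) (⟦poly⟧ f))
⟦poly⟧ (e ⊟ᵉ f) = ≋-trans (⟦⊟⟧ (poly e) (poly f)) (⊖-cong (⟦poly⟧ e) (⟦poly⟧ f))

-- In the convention of `denominator`, the entries n, ..., 1 encode the parts n + 1, ..., 2.
parts : ℕ → List ℕ
parts = applyDownFrom suc

denominator-U : ∀ n → denominator (parts n) ⊛ U n ≋ X^ 0
denominator-U zero = ≋-trans (⊛-congˡ (X^ 0) (q^≋X^ 0)) (solve 0 (con 1ℤ :* con 1ℤ := con 1ℤ) ≋-refl)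
denominator-U (suc n) = begin
  ((X^ 0 ⊖ X^ (2 + n)) ⊛ denominator (parts n)) ⊛ U (suc n)
    ≈⟨ solve 3 (λ y D u → (con 1ℤ :- y) :* D :* u := D :* ((con 1ℤ :- y) :* u)) ≋-refl (X^ (2 + n)) (denominator (parts n)) (U (suc n)) ⟩
  denominator (parts n) ⊛ ((X^ 0 ⊖ X^ (2 + n)) ⊛ U (suc n))
    ≈⟨ ⊛-congˡ (denominator (parts n)) (U-pred n) ⟨
  denominator (parts n) ⊛ U n
    ≈⟨ denominator-U n ⟩
  X^ 0 ∎
  where open SetoidReasoning seriesSetoid

excess : Expr → Expr → Series → Series
excess e r u = series e ⊛ u ⊖ series r

-- With D the denominator, D times `U n` is 1, so the difference has numerator e - D r.
excess-nonneg : ∀ n e r steps → T (check (parts n) (poly e ⊟ timesDenominator (parts n) (poly r)) steps) →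
                Nonneg (excess e r (U n))
excess-nonneg n e r steps ok = check-sound (parts n) _ steps ok (begin
  D ⊛ (series e ⊛ U n ⊖ series r)
    ≈⟨ solve 4 (λ D e u r → D :* (e :* u :- r) := e :* (D :* u) :- D :* r) ≋-refl D (series e) (U n) (series r) ⟩
  series e ⊛ (D ⊛ U n) ⊖ D ⊛ series r
    ≈⟨ ⊖-congʳ (D ⊛ series r) (⊛-congˡ (series e) (denominator-U n)) ⟩
  series e ⊛ X^ 0 ⊖ D ⊛ series r
    ≈⟨ ⊖-congʳ (D ⊛ series r) (solve 1 (λ e → e :* con 1ℤ := e) ≋-refl (series e)) ⟩
  series e ⊖ D ⊛ series r
    ≈⟨ ⊖-cong (⟦poly⟧ e) (⊛-congˡ D (⟦poly⟧ r)) ⟨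
  ⟦ poly e ⟧ ⊖ D ⊛ ⟦ poly r ⟧
    ≈⟨ ⊖-congˡ ⟦ poly e ⟧ (⟦timesDenominator⟧ (parts n) (poly r)) ⟨
  ⟦ poly e ⟧ ⊖ ⟦ timesDenominator (parts n) (poly r) ⟧
    ≈⟨ ⟦⊟⟧ (poly e) (timesDenominator (parts n) (poly r)) ⟨
  ⟦ poly e ⊟ timesDenominator (parts n) (poly r) ⟧ ∎)
  where
  open SetoidReasoning seriesSetoid
  D = denominator (parts n)

-- Recurrences in the largest part

F-num E-num : ℕ → Expr
F-num n = mono 2 ⊞ᵉ mono 2 ⊟ᵉ mono 0 ⊟ᵉ mono (2 + n)
E-num n = mono 1 ⊞ᵉ mono 1 ⊟ᵉ mono 0 ⊟ᵉ mono n

G-num : Expr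
G-num = mono 0 ⊟ᵉ mono 1 ⊟ᵉ mono 2 ⊞ᵉ mono 3

F-min E-min G-min : ℕ → Expr
F-min n = mono (3 + n) ⊞ᵉ mono (3 + n) ⊞ᵉ mono (5 + n) ⊟ᵉ mono 0 ⊟ᵉ mono 3
E-min n = mono 1 ⊞ᵉ mono 1 ⊞ᵉ mono 3 ⊞ᵉ mono (1 + n) ⊞ᵉ mono (2 + n) ⊟ᵉ mono 0 ⊟ᵉ mono 2
G-min n = mono 0 ⊟ᵉ mono 1 ⊞ᵉ mono 3 ⊞ᵉ mono (3 + n) ⊞ᵉ mono (4 + n)

-- The term q² is the true coefficient; it spares Expr a constant zero or a negation.
F-min-small : Expr
F-min-small = mono 2 ⊟ᵉ mono 0 ⊟ᵉ mono 3

-- Here, unlike in the header, the lower bound is already subtracted.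
F E G : ℕ → Series
F n = excess (F-num n) (F-min n) (U n)
E n = excess (E-num n) (E-min n) (U n)
G n = excess G-num (G-min n) (U n)

excess-U-pred : ∀ e r n → excess e r (U n) ≋ excess e r ((X^ 0 ⊖ X^ (2 + n)) ⊛ U (suc n))
excess-U-pred e r n = ⊖-congʳ (series r) (⊛-congˡ (series e) (U-pred n))

-- Nested in the same way as `X^`, so that the solver's evaluated terms match `X^ (k + n)`
-- definitionally.
times-q^ : ∀ {m} → Polynomial m → ℕ → Polynomial m → Polynomial m
times-q^ q zero    e = e
times-q^ q (suc k) e = q :* times-q^ q k e

-- Kept in multiplied form for `Nonneg-cancel`. Multiplying 1 - q + q³ by 1 - q^(2+n) cancels
-- q^(5+n) and creates q^(3+n), turning the new bound into the old one up to terms of favourable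
-- sign.
G-suc : ∀ n → (X^ 0 ⊖ X^ (2 + n)) ⊛ G (suc n) ≋
              G n ⊕ (X^ (2 + n) ⊕ X^ (2 + n) ⊛ X^ (4 + n) ⊕ X^ (2 + n) ⊛ X^ (5 + n))
G-suc n = ≋-trans
  (solve 3 (λ q x u →
      let c = λ k → times-q^ q k (con 1ℤ)
          v = λ k → times-q^ q k x
          num = c 0 :- c 1 :- c 2 :+ c 3
      in (c 0 :- v 2) :* (num :* u :- (c 0 :- c 1 :+ c 3 :+ v 4 :+ v 5)) :=
         num :* ((c 0 :- v 2) :* u) :- (c 0 :- c 1 :+ c 3 :+ v 3 :+ v 4)
           :+ (v 2 :+ v 2 :* v 4 :+ v 2 :* v 5))
    ≋-refl (q^ 1) (X^ n) (U (suc n)))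
  (⊕-congʳ (X^ (2 + n) ⊕ X^ (2 + n) ⊛ X^ (4 + n) ⊕ X^ (2 + n) ⊛ X^ (5 + n)) (≋-sym (excess-U-pred G-num (G-min n) n)))

-- Taking n = m + 1 makes the header's exponent M - 3 equal to m without subtraction. The increment
-- -q^(n+1) + q^(n+3) of `E-min` is contained in q^n times `G-min (suc n)`; the rest of that product
-- is the last bracket.
E-suc : ∀ m → let n = suc m in
        E (suc n) ≋ E n ⊕ X^ n ⊛ (G (suc n) ⊕ (X^ 3 ⊛ ((X^ 0 ⊖ X^ m) ⊛ U (suc n)) ⊕ (X^ 0 ⊕ X^ (4 + n) ⊕ X^ (5 + n))))
E-suc m = ≋-trans
  (solve 3 (λ q x u →
      let c = λ k → times-q^ q k (con 1ℤ)
          v = λ k → times-q^ q k x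
          num = λ y → c 1 :+ c 1 :- c 0 :- y
          min = λ y → c 1 :+ c 1 :+ c 3 :+ q :* y :+ q :* (q :* y) :- c 0 :- c 2
      in num (v 2) :* u :- min (v 2) :=
         num (v 1) :* ((c 0 :- v 3) :* u) :- min (v 1)
         :+ v 1 :* (((c 0 :- c 1 :- c 2 :+ c 3) :* u :- (c 0 :- c 1 :+ c 3 :+ v 5 :+ v 6))
           :+ (c 3 :* ((c 0 :- x) :* u) :+ (c 0 :+ v 5 :+ v 6))))
    ≋-refl (q^ 1) (X^ m) (U (suc (suc m))))
  (⊕-congʳ _ (≋-sym (excess-U-pred (E-num (suc m)) (E-min (suc m)) (suc m))))

-- `E-min` is shaped for this step: q^(3+n) (-1 + 2q - q² + q³) is the increment of `F-min` plus
-- q^(3+n).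
F-suc : ∀ n → F (suc n) ≋ F n ⊕ X^ (3 + n) ⊛ (E (suc n) ⊕ (X^ 0 ⊕ X^ (2 + n) ⊕ X^ (3 + n)))
F-suc n = ≋-trans
  (solve 3 (λ q x u →
      let c = λ k → times-q^ q k (con 1ℤ)
          v = λ k → times-q^ q k x
          num = λ y → c 2 :+ c 2 :- c 0 :- q :* (q :* y)
          min = λ y → times-q^ q 3 y :+ times-q^ q 3 y :+ times-q^ q 5 y :- c 0 :- c 3
      in num (v 1) :* u :- min (v 1) :=
         num x :* ((c 0 :- v 2) :* u) :- min x
         :+ v 3 :* (((c 1 :+ c 1 :- c 0 :- v 1) :* u :- (c 1 :+ c 1 :+ c 3 :+ v 2 :+ v 3 :- c 0 :- c 2))
           :+ (c 0 :+ v 2 :+ v 3)))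
    ≋-refl (q^ 1) (X^ n) (U (suc n)))
  (⊕-congʳ _ (≋-sym (excess-U-pred (F-num n) (F-min n) n)))

-- Induction on the largest part

G-nonneg : ∀ k → Nonneg (G (6 + k))
-- The factors 1 - q^12, 1 - q^6, 1 - q^7 and 1 - q^5 clear all poles of G. The last pair then reads
-- off the remaining polynomial, leaving numerator zero.
G-nonneg zero = excess-nonneg 6 G-num (G-min 6) ((0 , 11) ∷ (0 , 5) ∷ (23 , 6) ∷ (36 , 4) ∷ (39 , 0) ∷ []) _
G-nonneg (suc k) = Nonneg-cancel (7 + k) (Nonneg-resp (≋-sym (G-suc (6 + k)))
  (Nonneg-⊕ (G-nonneg k)
    (Nonneg-⊕ (Nonneg-⊕ (Nonneg-X^ (8 + k)) (Nonneg-⊛ (Nonneg-X^ (8 + k)) (Nonneg-X^ (10 + k))))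
      (Nonneg-⊛ (Nonneg-X^ (8 + k)) (Nonneg-X^ (11 + k))))))

E-nonneg : ∀ k → Nonneg (E (7 + k))
E-nonneg zero = excess-nonneg 7 (E-num 7) (E-min 7)
  ((0 , 3) ∷ (0 , 7) ∷ (0 , 5) ∷ (0 , 4) ∷ (28 , 6) ∷ (40 , 5) ∷ (46 , 0) ∷ []) _
E-nonneg (suc k) = Nonneg-resp (≋-sym (E-suc (6 + k)))
  (Nonneg-⊕ (E-nonneg k) (Nonneg-⊛ (Nonneg-X^ (7 + k))
    (Nonneg-⊕ (G-nonneg (2 + k))
      -- The omitted part is 6 + k, three below the largest part 9 + k; `omit-part` counts parts
      -- from 2, hence 4 + k.
      (Nonneg-⊕ (Nonneg-⊛ (Nonneg-X^ 3) (omit-part {4 + k} (s≤s (m≤n+m (4 + k) 3))))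
        (Nonneg-⊕ (Nonneg-⊕ (Nonneg-X^ 0) (Nonneg-X^ (11 + k))) (Nonneg-X^ (12 + k)))))))

F-nonneg : ∀ k → Nonneg (F (7 + k))
F-nonneg zero = excess-nonneg 7 (F-num 7) (F-min 7)
  ((0 , 11) ∷ (3 , 3) ∷ (0 , 7) ∷ (0 , 5) ∷ (0 , 13) ∷ (57 , 4) ∷ (62 , 0) ∷ []) _
F-nonneg (suc k) = Nonneg-resp (≋-sym (F-suc (7 + k)))
  (Nonneg-⊕ (F-nonneg k) (Nonneg-⊛ (Nonneg-X^ (10 + k))
    (Nonneg-⊕ (E-nonneg (suc k))
      (Nonneg-⊕ (Nonneg-⊕ (Nonneg-X^ 0) (Nonneg-X^ (9 + k))) (Nonneg-X^ (10 + k))))))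

-- Non-negativity of H

H-as-excess : ∀ L r → H L ≋ excess (F-num (suc L)) r (U (suc L)) ⊕ (series r ⊕ X^ 0 ⊕ X^ 3 ⊕ δ L 4 · q^ 9)
-- `H` is written with L + 1, whereas `U` unfolds at `suc L`.
H-as-excess L r = subst (λ k → q^ 3 ⊕ D ⊕ q^ 2 ⊛ (one ⊖ q^ k) ⊛ U k ⊖ (invPochSuc 2 L ⊖ one) ≋ target)
  (+-comm 1 L) (begin
  q^ 3 ⊕ D ⊕ q^ 2 ⊛ (one ⊖ q^ (suc L)) ⊛ U (suc L) ⊖ (invPochSuc 2 L ⊖ one)
    ≈⟨ ⊖-cong (⊕-cong (⊕-congʳ D (q^≋X^ 3)) (⊛-congʳ (U (suc L))
         (⊛-cong (q^≋X^ 2) (⊖-cong (q^≋X^ 0) (q^≋X^ (suc L))))))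
       (⊖-cong (remove-smallest-part L) (q^≋X^ 0)) ⟩
  X^ 3 ⊕ D ⊕ X^ 2 ⊛ (X^ 0 ⊖ X^ (suc L)) ⊛ U (suc L) ⊖ ((X^ 0 ⊖ X^ 2) ⊛ U (suc L) ⊖ X^ 0)
    ≈⟨ solve 5 (λ q x u D r →
         let c = λ k → times-q^ q k (con 1ℤ)
             v = λ k → times-q^ q k x
         in c 3 :+ D :+ c 2 :* (c 0 :- v 1) :* u :- ((c 0 :- c 2) :* u :- c 0) :=
            (c 2 :+ c 2 :- c 0 :- v 3) :* u :- r :+ (r :+ c 0 :+ c 3 :+ D))
       ≋-refl (q^ 1) (X^ L) (U (suc L)) D (series r) ⟩
  target ∎)
  where
  open SetoidReasoning seriesSetoid
  D = δ L 4 · q^ 9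
  target = excess (F-num (suc L)) r (U (suc L)) ⊕ (series r ⊕ X^ 0 ⊕ X^ 3 ⊕ D)

Nonneg-δ·q^ : ∀ m n k → Nonneg (δ m n · q^ k)
Nonneg-δ·q^ m n k .coeff i = 0≤* (δ-nonneg m n) (δ-nonneg i k)

H-nonneg-excess : ∀ L r → Nonneg (excess (F-num (suc L)) r (U (suc L))) →
                  Nonneg (series r ⊕ X^ 0 ⊕ X^ 3 ⊕ δ L 4 · q^ 9) → Nonneg (H L)
H-nonneg-excess L r p s = Nonneg-resp (≋-sym (H-as-excess L r)) (Nonneg-⊕ p s)

H-nonneg-small : ∀ L → Nonneg (excess (F-num (suc L)) F-min-small (U (suc L))) → Nonneg (H L)
H-nonneg-small L p = H-nonneg-excess L F-min-small p (Nonneg-resp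
  (solve 4 (λ a b c d → a :+ d := a :- b :- c :+ b :+ c :+ d) ≋-refl (X^ 2) (X^ 0) (X^ 3) (δ L 4 · q^ 9))
  (Nonneg-⊕ (Nonneg-X^ 2) (Nonneg-δ·q^ L 4 9)))

H-nonneg : ∀ l → Nonneg (H (3 + l))
H-nonneg 0 = H-nonneg-small 3
  (excess-nonneg 4 (F-num 4) F-min-small ((0 , 3) ∷ (0 , 11) ∷ (20 , 4) ∷ (24 , 0) ∷ []) _)
-- For L = 4 the bound also allows -1 at q^9, which the Kronecker term of `H` repays.
H-nonneg 1 = H-nonneg-excess 4 r
  (excess-nonneg 5 (F-num 5) r ((0 , 7) ∷ (0 , 5) ∷ (0 , 5) ∷ (25 , 4) ∷ (35 , 0) ∷ []) _)
  (Nonneg-resp residue (Nonneg-X^ 2))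
  where
  r = F-min-small ⊟ᵉ mono 9
  residue : X^ 2 ≋ series r ⊕ X^ 0 ⊕ X^ 3 ⊕ 1ℤ · q^ 9
  residue = ≋-trans
    (solve 4 (λ a b c d → a := a :- b :- c :- d :+ b :+ c :+ d) ≋-refl (X^ 2) (X^ 0) (X^ 3) (X^ 9))
    (⊕-congˡ (series r ⊕ X^ 0 ⊕ X^ 3)
      (≋-sym (≋-trans (pointwise λ n → ℤₚ.*-identityˡ (q^ 9 n)) (q^≋X^ 9))))
H-nonneg 2 = H-nonneg-small 5
  (excess-nonneg 6 (F-num 6) F-min-small ((0 , 5) ∷ (0 , 4) ∷ (0 , 6) ∷ (0 , 5) ∷ (28 , 3) ∷ (31 , 0) ∷ []) _)
-- From L = 6 on, n = L + 1 reaches 7, where the inductive bound on F starts; the terms 1 and q³ of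
-- `H` cancel its negative part.
H-nonneg (suc (suc (suc k))) = H-nonneg-excess (6 + k) (F-min (7 + k)) (F-nonneg k)
  (Nonneg-resp
    (solve 5 (λ a b c d e → a :+ a :+ b :+ e := a :+ a :+ b :- c :- d :+ c :+ d :+ e)
      ≋-refl (X^ (10 + k)) (X^ (12 + k)) (X^ 0) (X^ 3) (δ (6 + k) 4 · q^ 9))
    (Nonneg-⊕ (Nonneg-⊕ (Nonneg-⊕ (Nonneg-X^ (10 + k)) (Nonneg-X^ (10 + k))) (Nonneg-X^ (12 + k)))
      (Nonneg-δ·q^ (6 + k) 4 9)))

theorem4p4 : (L : ℕ) → 3 ≤ L → (n : ℕ) → 0ℤ ≤ℤ H L n
theorem4p4 (suc (suc (suc l))) (s≤s (s≤s (s≤s _))) = coeff (H-nonneg l)
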